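{- Let $q$ be a power of $2$, and let $L_0$ and $L_1$ be $2$-linear polynomials over $\mathbb F_{q^2}$. Then $L_1(x^{q+1})+L_0(x^2)$ is a permutation polynomial of $\mathbb F_{q^2}$ if and only if $L_1(x^q+x)=0$ (as a map on $\mathbb F_{q^2}$, i.e. $L_1(v^q+v)=0$ for every $v\in\mathbb F_{q^2}$) and $\ker L_0=\{0\}$.
   Context: A $2$-linear polynomial over $\mathbb F_{q^2}$ is a polynomial of the form $\sum_i a_ix^{2^i}$ with $a_i\in\mathbb F_{q^2}$. Polynomials over $\mathbb F_{q^2}$ are identified with the maps they induce on $\mathbb F_{q^2}$ (that is, one sets $x^{q^2}=x$), and $\ker L_0=\{v\in\mathbb F_{q^2}:L_0(v)=0\}$. A permutation polynomial of $\mathbb F_{q^2}$ is a polynomial over $\mathbb F_{q^2}$ whose induced map on $\mathbb F_{q^2}$ is a bijection. -}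

module Defs where

open import Algebra.Apartness.Bundles using (HeytingField; HeytingCommutativeRing)
open import Algebra.Bundles using (CommutativeRing)
open import Data.Fin.Base using (Fin; toℕ)
open import Data.List.Base using (List; []; _∷_; _++_; [_]; map; replicate)
open import Data.Nat.Base as ℕ using (ℕ)
open import Data.Vec.Functional as Vector using (Vector)
open import Function.Bundles using (Inverse)
open import Function.Definitions using (Bijective)
open import Level using (Level; _⊔_)
open import Relation.Binary.PropositionalEquality using (setoid)
open import Relation.Unary using (Pred)

-- On a finite carrier the equality is decidable and _#_ is its negation, so a
-- finite HeytingField is the same thing as a finite field in the usual sense.
module FieldPolynomials {c ℓ₁ ℓ₂ : Level} (F : HeytingField c ℓ₁ ℓ₂) where

  open HeytingField F using (heytingCommutativeRing)

  commutativeRing : CommutativeRing c ℓ₁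
  commutativeRing = HeytingCommutativeRing.commutativeRing heytingCommutativeRing

  open CommutativeRing commutativeRing public
    using (Carrier; _≈_; _+_; _*_; 0#; 1#)

  open import Algebra.Properties.Semiring.Exp
    (CommutativeRing.semiring commutativeRing) public
    using (_^_)

  HasCardinality : ℕ → Set (c ⊔ ℓ₁)
  HasCardinality n = Inverse (CommutativeRing.setoid commutativeRing) (setoid (Fin n))

  -- Coefficients in order of increasing degree; trailing zeros are allowed.
  Poly : Set c
  Poly = List Carrier

  infixl 6 _+ₚ_
  infixl 7 _*ₚ_
  infixr 7 _·ₚ_
  infixr 9 _∘ₚ_

  _+ₚ_ : Poly → Poly → Poly
  []      +ₚ r       = r
  (a ∷ p) +ₚ []      = a ∷ p
  (a ∷ p) +ₚ (b ∷ r) = a + b ∷ p +ₚ r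

  _·ₚ_ : Carrier → Poly → Poly
  a ·ₚ p = map (a *_) p

  _*ₚ_ : Poly → Poly → Poly
  []      *ₚ r = []
  (a ∷ p) *ₚ r = a ·ₚ r +ₚ (0# ∷ p *ₚ r)

  -- Substitution: p ∘ₚ r is p(r(x)).
  _∘ₚ_ : Poly → Poly → Poly
  []      ∘ₚ r = []
  (a ∷ p) ∘ₚ r = [ a ] +ₚ r *ₚ (p ∘ₚ r)

  X^_ : ℕ → Poly
  X^ n = replicate n 0# ++ [ 1# ]

  ⟦_⟧ : Poly → Carrier → Carrier
  ⟦ []    ⟧ x = 0#
  ⟦ a ∷ p ⟧ x = a + x * ⟦ p ⟧ x

  -- Σᵢ aᵢ x^(2^i)
  twoLinear : {n : ℕ} → Vector Carrier n → Poly
  twoLinear a = Vector.foldr _+ₚ_ [] (λ i → a i ·ₚ X^ (2 ℕ.^ toℕ i))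

  IsPermutationPolynomial : Poly → Set (c ⊔ ℓ₁)
  IsPermutationPolynomial p = Bijective _≈_ _≈_ ⟦ p ⟧

  Ker : Poly → Pred Carrier ℓ₁
  Ker p v = ⟦ p ⟧ v ≈ 0#

{-# OPTIONS --safe #-}

-- Write f(x) = L₁(x^(q+1)) + L₀(x²).  Since L₀, L₁ and squaring are additive,
--   f(x + a) = f(x) + L₁(x^q a + x a^q + a^(q+1)) + L₀(a²),
-- and for a ≠ 0 the element x^q a + x a^q, being the trace of x a^q, ranges over
-- the whole subfield 𝔽_q = {t : t^q = t}.  As a^(q+1) ∈ 𝔽_q, injectivity of f means
-- that L₀(a²) ∈ L₁(𝔽_q) only for a = 0.  With 0 ∈ L₁(𝔽_q) this makes L₀ injective,
-- hence (finiteness) surjective, so L₁(𝔽_q) = {0}.  Conversely, if L₁ vanishes on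
-- traces it vanishes on 𝔽_q, so f(x) = L₀(x²).

module Submission where

open import Defs
open import Algebra.Apartness.Bundles using (HeytingField)
open import Data.Nat.Base as ℕ using (ℕ)
open import Data.Product.Base using (_×_; ∃)
open import Data.Vec.Functional using (Vector)
open import Function.Bundles using (_⇔_)
open import Level using (Level)
open import Relation.Binary.PropositionalEquality using (_≡_)
open import Relation.Unary using (_≐_)

open import Algebra.Bundles using (CommutativeRing)
open import Data.Fin.Base using (Fin; zero; suc; toℕ; punchIn)
open import Data.Fin.Permutation using (Permutation; permutation; _⟨$⟩ʳ_)
open import Data.Fin.Properties using (_≟_; any?; ¬∀⟶∃¬; injective⇒≤; punchInᵢ≢i; suc-injective)
open import Data.List.Base using ([]; _∷_; _++_; [_]; length; replicate)
open import Data.List.Properties using (length-replicate)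
open import Data.Nat.Properties as ℕ using ()
open import Data.Product.Base using (_,_; proj₁; proj₂)
open import Data.Vec.Functional as Vector using ()
open import Function.Base using (_∘_)
open import Function.Bundles using (Inverse; mk⇔)
open import Function.Definitions using (Congruent; Injective; Bijective)
open import Relation.Binary.Definitions using (Decidable)
open import Relation.Binary.PropositionalEquality as ≡ using ()
open import Relation.Nullary.Decidable using (Dec; yes; no; map′)
open import Relation.Nullary.Negation using (¬_; contradiction)
import Algebra.Apartness.Properties.HeytingCommutativeRing as HeytingProperties
import Algebra.Properties.CommutativeMonoid.Sum as CommutativeMonoidSum
import Algebra.Properties.CommutativeSemiring.Exp as CommutativeSemiringExp
import Algebra.Properties.Ring as RingProperties
import Algebra.Properties.Semiring.Exp as SemiringExp
import Algebra.Solver.Ring.NaturalCoefficients.Default as Solver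
import Relation.Binary.Reasoning.Setoid as SetoidReasoning

private variable
  c ℓ₁ ℓ₂ : Level

-- Adjoining j to the values of f gives n + 1 values in Fin n.
Fin-injective⇒surjective : ∀ {n} {f : Fin n → Fin n} → Injective _≡_ _≡_ f →
                           ∀ j → ∃ λ i → f i ≡ j
Fin-injective⇒surjective {n} {f} inj j with any? (λ i → f i ≟ j)
... | yes hit  = hit
... | no  miss = contradiction (injective⇒≤ g-injective) ℕ.1+n≰n
  where
  g : Fin (ℕ.suc n) → Fin n
  g zero    = j
  g (suc i) = f i

  g-injective : Injective _≡_ _≡_ g
  g-injective {zero}  {zero}  _  = ≡.refl
  g-injective {zero}  {suc k} eq = contradiction (k , ≡.sym eq) miss
  g-injective {suc i} {zero}  eq = contradiction (i , eq) miss
  g-injective {suc i} {suc k} eq = ≡.cong suc (inj eq)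

-- Evaluation of polynomials respects sums, products and substitution.

module PolynomialEvaluation (F : HeytingField c ℓ₁ ℓ₂) where

  open FieldPolynomials F
  open CommutativeRing commutativeRing hiding (Carrier; _≈_; _+_; _*_; 0#; 1#; zero)
  open SetoidReasoning setoid
  open SemiringExp semiring using (^-congˡ; ^-assocʳ)
  module S = Solver commutativeSemiring

  ⟦⟧-cong : ∀ p → Congruent _≈_ _≈_ ⟦ p ⟧
  ⟦⟧-cong []      x≈y = refl
  ⟦⟧-cong (a ∷ p) x≈y = +-congˡ (*-cong x≈y (⟦⟧-cong p x≈y))

  ⟦+ₚ⟧ : ∀ p r x → ⟦ p +ₚ r ⟧ x ≈ ⟦ p ⟧ x + ⟦ r ⟧ x
  ⟦+ₚ⟧ []      r       x = sym (+-identityˡ _)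
  ⟦+ₚ⟧ (a ∷ p) []      x = sym (+-identityʳ _)
  ⟦+ₚ⟧ (a ∷ p) (b ∷ r) x = begin
    a + b + x * ⟦ p +ₚ r ⟧ x               ≈⟨ +-congˡ (*-congˡ (⟦+ₚ⟧ p r x)) ⟩
    a + b + x * (⟦ p ⟧ x + ⟦ r ⟧ x)        ≈⟨ S.solve 5 (λ a b x u v →
      a S.:+ b S.:+ x S.:* (u S.:+ v) S.:= (a S.:+ x S.:* u) S.:+ (b S.:+ x S.:* v))
      refl a b x (⟦ p ⟧ x) (⟦ r ⟧ x) ⟩
    (a + x * ⟦ p ⟧ x) + (b + x * ⟦ r ⟧ x)  ∎

  ⟦·ₚ⟧ : ∀ a p x → ⟦ a ·ₚ p ⟧ x ≈ a * ⟦ p ⟧ x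
  ⟦·ₚ⟧ a []      x = sym (zeroʳ a)
  ⟦·ₚ⟧ a (b ∷ p) x = begin
    a * b + x * ⟦ a ·ₚ p ⟧ x   ≈⟨ +-congˡ (*-congˡ (⟦·ₚ⟧ a p x)) ⟩
    a * b + x * (a * ⟦ p ⟧ x)  ≈⟨ S.solve 4 (λ a b x u →
      a S.:* b S.:+ x S.:* (a S.:* u) S.:= a S.:* (b S.:+ x S.:* u)) refl a b x (⟦ p ⟧ x) ⟩
    a * (b + x * ⟦ p ⟧ x)      ∎

  ⟦*ₚ⟧ : ∀ p r x → ⟦ p *ₚ r ⟧ x ≈ ⟦ p ⟧ x * ⟦ r ⟧ x
  ⟦*ₚ⟧ []      r x = sym (zeroˡ _)
  ⟦*ₚ⟧ (a ∷ p) r x = begin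
    ⟦ a ·ₚ r +ₚ (0# ∷ p *ₚ r) ⟧ x                 ≈⟨ ⟦+ₚ⟧ (a ·ₚ r) _ x ⟩
    ⟦ a ·ₚ r ⟧ x + (0# + x * ⟦ p *ₚ r ⟧ x)        ≈⟨ +-cong (⟦·ₚ⟧ a r x) (+-congˡ (*-congˡ (⟦*ₚ⟧ p r x))) ⟩
    a * ⟦ r ⟧ x + (0# + x * (⟦ p ⟧ x * ⟦ r ⟧ x))  ≈⟨ S.solve 4 (λ a x u v →
      a S.:* v S.:+ (S.con 0 S.:+ x S.:* (u S.:* v)) S.:= (a S.:+ x S.:* u) S.:* v)
      refl a x (⟦ p ⟧ x) (⟦ r ⟧ x) ⟩
    (a + x * ⟦ p ⟧ x) * ⟦ r ⟧ x                   ∎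

  ⟦∘ₚ⟧ : ∀ p r x → ⟦ p ∘ₚ r ⟧ x ≈ ⟦ p ⟧ (⟦ r ⟧ x)
  ⟦∘ₚ⟧ []      r x = refl
  ⟦∘ₚ⟧ (a ∷ p) r x = begin
    ⟦ [ a ] +ₚ r *ₚ (p ∘ₚ r) ⟧ x           ≈⟨ ⟦+ₚ⟧ [ a ] (r *ₚ (p ∘ₚ r)) x ⟩
    (a + x * 0#) + ⟦ r *ₚ (p ∘ₚ r) ⟧ x     ≈⟨ +-cong (trans (+-congˡ (zeroʳ x)) (+-identityʳ a)) (⟦*ₚ⟧ r _ x) ⟩
    a + ⟦ r ⟧ x * ⟦ p ∘ₚ r ⟧ x             ≈⟨ +-congˡ (*-congˡ (⟦∘ₚ⟧ p r x)) ⟩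
    a + ⟦ r ⟧ x * ⟦ p ⟧ (⟦ r ⟧ x)          ∎

  ⟦X^⟧ : ∀ n x → ⟦ X^ n ⟧ x ≈ x ^ n
  ⟦X^⟧ ℕ.zero    x = trans (+-congˡ (zeroʳ x)) (+-identityʳ 1#)
  ⟦X^⟧ (ℕ.suc n) x = trans (+-identityˡ _) (*-congˡ (⟦X^⟧ n x))

  -- Additive maps in characteristic 2.

  Additive : (Carrier → Carrier) → Set _
  Additive f = ∀ x y → f (x + y) ≈ f x + f y

  module _ (1+1≈0 : 1# + 1# ≈ 0#) where

    x+x≈0 : ∀ x → x + x ≈ 0#
    x+x≈0 x = begin
      x + x          ≈⟨ S.solve 1 (λ x → x S.:+ x S.:= (S.con 1 S.:+ S.con 1) S.:* x) refl x ⟩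
      (1# + 1#) * x  ≈⟨ *-congʳ 1+1≈0 ⟩
      0# * x         ≈⟨ zeroˡ x ⟩
      0#             ∎

    x+y+y≈x : ∀ x y → x + y + y ≈ x
    x+y+y≈x x y = begin
      x + y + y    ≈⟨ +-assoc x y y ⟩
      x + (y + y)  ≈⟨ +-congˡ (x+x≈0 y) ⟩
      x + 0#       ≈⟨ +-identityʳ x ⟩
      x            ∎

    x+y≈0⇒x≈y : ∀ {x y} → x + y ≈ 0# → x ≈ y
    x+y≈0⇒x≈y {x} {y} x+y≈0 = begin
      x          ≈⟨ x+y+y≈x x y ⟨
      x + y + y  ≈⟨ +-congʳ x+y≈0 ⟩
      0# + y     ≈⟨ +-identityˡ y ⟩
      y          ∎

    square-additive : Additive (_^ 2)
    square-additive x y = begin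
      (x + y) ^ 2                    ≈⟨ S.solve 2 (λ x y →
        (x S.:+ y) S.:* ((x S.:+ y) S.:* S.con 1) S.:=
        (x S.:* (x S.:* S.con 1)) S.:+ y S.:* (y S.:* S.con 1) S.:+ x S.:* y S.:+ x S.:* y) refl x y ⟩
      x ^ 2 + y ^ 2 + x * y + x * y  ≈⟨ x+y+y≈x _ _ ⟩
      x ^ 2 + y ^ 2                  ∎

    -- `x ^ (2 ^ k)` is squaring iterated `k` times, and squaring is additive because its cross
    -- terms cancel in characteristic 2.
    frobenius-additive : ∀ k → Additive (_^ (2 ℕ.^ k))
    frobenius-additive ℕ.zero    x y = distribʳ 1# x y
    frobenius-additive (ℕ.suc k) x y = begin
      (x + y) ^ (2 ℕ.* n)              ≈⟨ ^-assocʳ (x + y) 2 n ⟨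
      ((x + y) ^ 2) ^ n                ≈⟨ ^-congˡ n (square-additive x y) ⟩
      (x ^ 2 + y ^ 2) ^ n              ≈⟨ frobenius-additive k (x ^ 2) (y ^ 2) ⟩
      (x ^ 2) ^ n + (y ^ 2) ^ n        ≈⟨ +-cong (^-assocʳ x 2 n) (^-assocʳ y 2 n) ⟩
      x ^ (2 ℕ.* n) + y ^ (2 ℕ.* n)    ∎
      where n = 2 ℕ.^ k

    -- The exponents are kept arbitrary because the tail of a 2-linear
    -- polynomial starts at x² rather than at x.
    linearised-additive : ∀ {n} (a : Vector Carrier n) (e : Fin n → ℕ) →
      Additive ⟦ Vector.foldr _+ₚ_ [] (λ i → a i ·ₚ X^ (2 ℕ.^ e i)) ⟧
    linearised-additive {ℕ.zero}  a e x y = sym (+-identityˡ 0#)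
    linearised-additive {ℕ.suc n} a e x y = begin
      ⟦ a₀ ·ₚ X^ E +ₚ p ⟧ (x + y)                      ≈⟨ split (x + y) ⟩
      a₀ * (x + y) ^ E + ⟦ p ⟧ (x + y)                 ≈⟨ +-cong (*-congˡ (frobenius-additive (e zero) x y))
                                                          (linearised-additive (a ∘ suc) (e ∘ suc) x y) ⟩
      a₀ * (x ^ E + y ^ E) + (⟦ p ⟧ x + ⟦ p ⟧ y)       ≈⟨ S.solve 5 (λ a u v w z →
        a S.:* (u S.:+ v) S.:+ (w S.:+ z) S.:= (a S.:* u S.:+ w) S.:+ (a S.:* v S.:+ z))
        refl a₀ (x ^ E) (y ^ E) (⟦ p ⟧ x) (⟦ p ⟧ y) ⟩
      (a₀ * x ^ E + ⟦ p ⟧ x) + (a₀ * y ^ E + ⟦ p ⟧ y)  ≈⟨ +-cong (split x) (split y) ⟨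
      ⟦ a₀ ·ₚ X^ E +ₚ p ⟧ x + ⟦ a₀ ·ₚ X^ E +ₚ p ⟧ y    ∎
      where
      a₀ = a zero
      E = 2 ℕ.^ e zero
      p = Vector.foldr _+ₚ_ [] (λ i → a (suc i) ·ₚ X^ (2 ℕ.^ e (suc i)))

      split : ∀ z → ⟦ a₀ ·ₚ X^ E +ₚ p ⟧ z ≈ a₀ * z ^ E + ⟦ p ⟧ z
      split z = trans (⟦+ₚ⟧ (a₀ ·ₚ X^ E) p z)
        (+-congʳ (trans (⟦·ₚ⟧ a₀ (X^ E) z) (*-congˡ (⟦X^⟧ E z))))

    twoLinear-additive : ∀ {n} (a : Vector Carrier n) → Additive ⟦ twoLinear a ⟧
    twoLinear-additive a = linearised-additive a toℕ

  additive⇒0 : ∀ {f} → Congruent _≈_ _≈_ f → Additive f → f 0# ≈ 0#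
  additive⇒0 {f} f-cong f-add = RingProperties.+-cancelˡ ring (f 0#) (f 0#) 0# (begin
    f 0# + f 0#  ≈⟨ f-add 0# 0# ⟨
    f (0# + 0#)  ≈⟨ f-cong (+-identityˡ 0#) ⟩
    f 0#         ≈⟨ +-identityʳ (f 0#) ⟨
    f 0# + 0#    ∎)

  -- Monic polynomials and division by a linear factor.

  monic : Poly → Poly
  monic p = p ++ [ 1# ]

  -- monic (quotient r a p) is the quotient of monic (a ∷ p) by X - r.
  quotient : Carrier → Carrier → Poly → Poly
  quotient r a []      = []
  quotient r a (b ∷ p) = ⟦ monic (b ∷ p) ⟧ r ∷ quotient r b p

  -- f(x) - f(r) = (x - r) s(x), with the subtractions moved across so that the
  -- semiring solver applies.
  quotient-correct : ∀ r a p x → let s = ⟦ monic (quotient r a p) ⟧ x in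
    ⟦ monic (a ∷ p) ⟧ x + r * s ≈ ⟦ monic (a ∷ p) ⟧ r + x * s
  quotient-correct r a []      x = S.solve 3 (λ r a x →
    (a S.:+ x S.:* (S.con 1 S.:+ x S.:* S.con 0)) S.:+ r S.:* (S.con 1 S.:+ x S.:* S.con 0) S.:=
    (a S.:+ r S.:* (S.con 1 S.:+ r S.:* S.con 0)) S.:+ x S.:* (S.con 1 S.:+ x S.:* S.con 0))
    refl r a x
  quotient-correct r a (b ∷ p) x = begin
    (a + x * u) + r * (v + x * s)  ≈⟨ S.solve 6 (λ r a x u v s →
      (a S.:+ x S.:* u) S.:+ r S.:* (v S.:+ x S.:* s) S.:=
      (a S.:+ r S.:* v) S.:+ x S.:* (u S.:+ r S.:* s)) refl r a x u v s ⟩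
    (a + r * v) + x * (u + r * s)  ≈⟨ +-congˡ (*-congˡ (quotient-correct r b p x)) ⟩
    (a + r * v) + x * (v + x * s)  ∎
    where
    u = ⟦ monic (b ∷ p) ⟧ x
    v = ⟦ monic (b ∷ p) ⟧ r
    s = ⟦ monic (quotient r b p) ⟧ x

  length-quotient : ∀ r a p → length (quotient r a p) ≡ length p
  length-quotient r a []      = ≡.refl
  length-quotient r a (b ∷ p) = ≡.cong ℕ.suc (length-quotient r b p)

-- Finite fields: inverses, counting of roots, Fermat's theorem.

module FiniteField (F : HeytingField c ℓ₁ ℓ₂) {N : ℕ}
  (card : FieldPolynomials.HasCardinality F N) where

  open FieldPolynomials F
  open PolynomialEvaluation F
  open CommutativeRing commutativeRing hiding (Carrier; _≈_; _+_; _*_; 0#; 1#; zero)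
  open SetoidReasoning setoid
  open SemiringExp semiring using (^-congˡ; ^-assocʳ)
  open RingProperties ring using (-1*x≈-x; -‿involutive)
  open CommutativeMonoidSum *-commutativeMonoid using ()
    renaming ( sum to ∏; sum-permute to ∏-permute; sum-remove to ∏-remove
             ; ∑-distrib-+ to ∏-distrib-*; sum-cong-≋ to ∏-cong
             ; sum-replicate to ∏-replicate; sum-replicate-zero to ∏-replicate-one)
  open Inverse card using (to; from; to-cong; strictlyInverseˡ; strictlyInverseʳ)

  to-injective : ∀ {x y} → to x ≡ to y → x ≈ y
  to-injective {x} {y} eq = begin
    x            ≈⟨ strictlyInverseʳ x ⟨
    from (to x)  ≡⟨ ≡.cong from eq ⟩
    from (to y)  ≈⟨ strictlyInverseʳ y ⟩
    y            ∎

  from-injective : Injective _≡_ _≈_ from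
  from-injective {i} {j} eq =
    ≡.trans (≡.sym (strictlyInverseˡ i)) (≡.trans (to-cong eq) (strictlyInverseˡ j))

  _≈?_ : Decidable _≈_
  x ≈? y = map′ to-injective to-cong (to x ≟ to y)

  1≉0 : ¬ (1# ≈ 0#)
  1≉0 1≈0 = proj₂ (HeytingField.tight F 1# 0#) 1≈0
    (HeytingProperties.1#0 (HeytingField.heytingCommutativeRing F))

  -- Tightness turns `x ≉ 0` only into the double negation of apartness. Searching the finite
  -- carrier makes the existence of an inverse decidable, so it is enough to refute the failure of
  -- the search.
  ≉0⇒invertible : ∀ {x} → ¬ (x ≈ 0#) → ∃ λ y → y * x ≈ 1#
  ≉0⇒invertible {x} x≉0 with any? (λ i → (from i * x) ≈? 1#)
  ... | yes (i , eq) = from i , eq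
  ... | no  none     = contradiction (proj₁ (HeytingField.tight F x 0#) λ x#0 →
    let y , y*[x-0]≈1 , _ = HeytingField.#⇒invertible F x#0 in
    none (to y , (begin
      from (to y) * x  ≈⟨ *-cong (strictlyInverseʳ y)
        (sym (HeytingProperties.x-0≈x (HeytingField.heytingCommutativeRing F) x)) ⟩
      y * (x - 0#)     ≈⟨ y*[x-0]≈1 ⟩
      1#               ∎))) x≉0

  *-cancelˡ-≉0 : ∀ {x y z} → ¬ (x ≈ 0#) → x * y ≈ x * z → y ≈ z
  *-cancelˡ-≉0 {x} {y} {z} x≉0 eq = begin
    y              ≈⟨ *-identityˡ y ⟨
    1# * y         ≈⟨ *-congʳ x⁻¹x≈1 ⟨
    x⁻¹ * x * y    ≈⟨ *-assoc _ _ _ ⟩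
    x⁻¹ * (x * y)  ≈⟨ *-congˡ eq ⟩
    x⁻¹ * (x * z)  ≈⟨ *-assoc _ _ _ ⟨
    x⁻¹ * x * z    ≈⟨ *-congʳ x⁻¹x≈1 ⟩
    1# * z         ≈⟨ *-identityˡ z ⟩
    z              ∎
    where
    x⁻¹ = proj₁ (≉0⇒invertible x≉0)
    x⁻¹x≈1 = proj₂ (≉0⇒invertible x≉0)

  x*y≉0 : ∀ {x y} → ¬ (x ≈ 0#) → ¬ (y ≈ 0#) → ¬ (x * y ≈ 0#)
  x*y≉0 {x} x≉0 y≉0 xy≈0 = y≉0 (*-cancelˡ-≉0 x≉0 (trans xy≈0 (sym (zeroʳ x))))

  x^n≉0 : ∀ {x} → ¬ (x ≈ 0#) → ∀ n → ¬ (x ^ n ≈ 0#)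
  x^n≉0 x≉0 ℕ.zero    = 1≉0
  x^n≉0 x≉0 (ℕ.suc n) = x*y≉0 x≉0 (x^n≉0 x≉0 n)

  -- The pigeonhole principle on `Fin N`, transported along the enumeration of the field.
  injective⇒bijective : ∀ {f} → Congruent _≈_ _≈_ f → Injective _≈_ _≈_ f → Bijective _≈_ _≈_ f
  injective⇒bijective {f} f-cong f-inj = f-inj , λ y →
    let i , eq = Fin-injective⇒surjective {f = to ∘ f ∘ from}
                   (from-injective ∘ f-inj ∘ to-injective) (to y)
    in from i , λ z≈x → trans (f-cong z≈x) (to-injective eq)

  -- Induction on `p`: dividing by `X - r₀` lowers the degree by one, and the other roots survive in
  -- the quotient. The appended leading 1 makes `length p` the exact degree of `monic p`, even if
  -- `p` itself ends in zeros.
  roots≤degree : ∀ p {m} (r : Fin m → Carrier) → Injective _≡_ _≈_ r →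
                 (∀ i → ⟦ monic p ⟧ (r i) ≈ 0#) → m ℕ.≤ length p
  roots≤degree p       {ℕ.zero}  r r-inj root = ℕ.z≤n
  -- `monic []` is the constant 1, which has no root.
  roots≤degree []      {ℕ.suc m} r r-inj root = contradiction
    (trans (sym (⟦X^⟧ 0 (r zero))) (root zero)) 1≉0
  roots≤degree (a ∷ p) {ℕ.suc m} r r-inj root = ℕ.s≤s
    (≡.subst (m ℕ.≤_) (length-quotient r₀ a p)
      (roots≤degree (quotient r₀ a p) (r ∘ suc) (suc-injective ∘ r-inj) quotient-root))
    where
    r₀ = r zero

    quotient-root : ∀ i → ⟦ monic (quotient r₀ a p) ⟧ (r (suc i)) ≈ 0#
    quotient-root i with ⟦ monic (quotient r₀ a p) ⟧ (r (suc i)) ≈? 0#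
    ... | yes s≈0 = s≈0
    -- Both `r₀` and `r (suc i)` are roots, so the division identity gives `s * r₀ ≈ s * r (suc i)`;
    -- cancelling `s` would make two distinct indices share a root.
    ... | no  s≉0 = contradiction (r-inj (*-cancelˡ-≉0 s≉0 (begin
      s * r₀                                  ≈⟨ *-comm s r₀ ⟩
      r₀ * s                                  ≈⟨ +-identityˡ _ ⟨
      0# + r₀ * s                             ≈⟨ +-congʳ (root (suc i)) ⟨
      ⟦ monic (a ∷ p) ⟧ (r (suc i)) + r₀ * s  ≈⟨ quotient-correct r₀ a p (r (suc i)) ⟩
      ⟦ monic (a ∷ p) ⟧ r₀ + r (suc i) * s    ≈⟨ +-congʳ (root zero) ⟩
      0# + r (suc i) * s                      ≈⟨ +-identityˡ _ ⟩
      r (suc i) * s                           ≈⟨ *-comm _ s ⟩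
      s * r (suc i)                           ∎))) λ ()
      where s = ⟦ monic (quotient r₀ a p) ⟧ (r (suc i))

  -- Otherwise all `N` elements would be roots of a monic polynomial of degree `n < N`.
  nonFixedPoint : ∀ n → 2 ℕ.≤ n → n ℕ.< N → ∃ λ w → ¬ (w ^ n ≈ w)
  -- Writing `n` as `2 + d` separates the constant and linear coefficients from the `d` zeros below
  -- the leading 1.
  nonFixedPoint n 2≤n n<N with ℕ.m≤n⇒∃[o]m+o≡n 2≤n
  ... | d , ≡.refl = let i , w≉ = ¬∀⟶∃¬ N _ (λ i → (from i ^ (2 ℕ.+ d)) ≈? from i) notAllFixed
                     in from i , w≉
    where
    -- X^(d+2) - X
    p : Poly
    p = 0# ∷ - 1# ∷ replicate d 0#

    ⟦p⟧≈0 : ∀ {x} → x ^ (2 ℕ.+ d) ≈ x → ⟦ monic p ⟧ x ≈ 0#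
    ⟦p⟧≈0 {x} fixed = begin
      0# + x * (- 1# + x * ⟦ X^ d ⟧ x)  ≈⟨ +-identityˡ _ ⟩
      x * (- 1# + x * ⟦ X^ d ⟧ x)       ≈⟨ distribˡ x _ _ ⟩
      x * - 1# + x * (x * ⟦ X^ d ⟧ x)   ≈⟨ +-cong (trans (*-comm x _) (-1*x≈-x x))
                                             (trans (*-congˡ (*-congˡ (⟦X^⟧ d x))) fixed) ⟩
      - x + x                           ≈⟨ -‿inverseˡ x ⟩
      0#                                ∎

    notAllFixed : ¬ (∀ i → from i ^ (2 ℕ.+ d) ≈ from i)
    notAllFixed fixed = ℕ.<⇒≱ n<N (≡.subst (λ l → N ℕ.≤ 2 ℕ.+ l) (length-replicate d)
      (roots≤degree p from from-injective (⟦p⟧≈0 ∘ fixed)))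

  -- Fermat's theorem, by comparing products over the field.

  pointMass : ∀ {A : Set} → Dec A → Carrier → Carrier
  pointMass (yes _) a = a
  pointMass (no  _) a = 1#

  ∏-pointMass : ∀ {n} (i : Fin n) a → ∏ (λ j → pointMass (j ≟ i) a) ≈ a
  ∏-pointMass {ℕ.suc n} i a = begin
    ∏ t                               ≈⟨ ∏-remove {i = i} t ⟩
    t i * ∏ (Vector.removeAt t i)     ≈⟨ *-cong at-i (∏-cong off-i) ⟩
    a * ∏ (Vector.replicate n 1#)     ≈⟨ *-congˡ (∏-replicate-one n) ⟩
    a * 1#                            ≈⟨ *-identityʳ a ⟩
    a                                 ∎
    where
    t : Vector Carrier (ℕ.suc n)
    t j = pointMass (j ≟ i) a

    at-i : t i ≈ a
    at-i with i ≟ i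
    ... | yes _   = refl
    ... | no  i≢i = contradiction ≡.refl i≢i

    off-i : ∀ j → Vector.removeAt t i j ≈ 1#
    off-i j with punchIn i j ≟ i
    ... | yes eq = contradiction eq (punchInᵢ≢i i j)
    ... | no  _  = refl

  ∏≉0 : ∀ {n} (t : Vector Carrier n) → (∀ i → ¬ (t i ≈ 0#)) → ¬ (∏ t ≈ 0#)
  ∏≉0 {ℕ.zero}  t t≉0 = 1≉0
  ∏≉0 {ℕ.suc n} t t≉0 = x*y≉0 (t≉0 zero) (∏≉0 (t ∘ suc) (t≉0 ∘ suc))

  -- An element of `Fin n` serves as evidence that `n` is positive; `0# ^ 0` is 1.
  0^n≈0 : ∀ {n} → Fin n → 0# ^ n ≈ 0#
  0^n≈0 {ℕ.suc n} _ = zeroˡ _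

  -- Multiplication by a ≠ 0 permutes the field; compare the products over all
  -- elements, with the factor 0 replaced by 1.
  fermat : ∀ a → a ^ N ≈ a
  fermat a with a ≈? 0#
  ... | yes a≈0 = trans (^-congˡ N a≈0) (trans (0^n≈0 (to 0#)) (sym a≈0))
  ... | no  a≉0 = sym (*-cancelˡ-≉0 (∏≉0 unit unit≉0) (begin
    -- The extra factor `a` is spread as `mass`, sitting at the index of 0 only. It supplies the
    -- factor missing there, so the exponent comes out as `N` and not `N - 1`.
    ∏ unit * a                                ≈⟨ *-cong (∏-permute unit π) (sym (∏-pointMass (to 0#) a)) ⟩
    ∏ (unit ∘ (π ⟨$⟩ʳ_)) * ∏ mass             ≈⟨ ∏-distrib-* (unit ∘ (π ⟨$⟩ʳ_)) mass ⟨
    ∏ (λ i → unit (π ⟨$⟩ʳ i) * mass i)        ≈⟨ ∏-cong pointwise ⟩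
    ∏ (λ i → unit i * a)                      ≈⟨ ∏-distrib-* unit (λ _ → a) ⟩
    ∏ unit * ∏ (Vector.replicate N a)         ≈⟨ *-congˡ (∏-replicate N) ⟩
    ∏ unit * a ^ N                            ∎))
    where
    a⁻¹ = proj₁ (≉0⇒invertible a≉0)
    a⁻¹a≈1 = proj₂ (≉0⇒invertible a≉0)

    scale : Carrier → Fin N → Fin N
    scale b i = to (b * from i)

    scale-inverse : ∀ {b d} → b * d ≈ 1# → ∀ i → scale b (scale d i) ≡ i
    scale-inverse {b} {d} bd≈1 i = ≡.trans (to-cong (begin
      b * from (to (d * from i))  ≈⟨ *-congˡ (strictlyInverseʳ _) ⟩
      b * (d * from i)            ≈⟨ *-assoc _ _ _ ⟨
      b * d * from i              ≈⟨ *-congʳ bd≈1 ⟩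
      1# * from i                 ≈⟨ *-identityˡ _ ⟩
      from i                      ∎)) (strictlyInverseˡ i)

    π : Permutation N N
    π = permutation (scale a) (scale a⁻¹)
      (scale-inverse (trans (*-comm a a⁻¹) a⁻¹a≈1)) (scale-inverse a⁻¹a≈1)

    unitAt : ∀ {A : Set} → Dec A → Carrier → Carrier
    unitAt (yes _) x = 1#
    unitAt (no  _) x = x

    unit mass : Vector Carrier N
    unit i = unitAt (i ≟ to 0#) (from i)
    mass i = pointMass (i ≟ to 0#) a

    from≈0 : ∀ {i} → i ≡ to 0# → from i ≈ 0#
    from≈0 ≡.refl = strictlyInverseʳ 0#

    ≡to0 : ∀ {i} → from i ≈ 0# → i ≡ to 0#
    ≡to0 eq = from-injective (trans eq (sym (strictlyInverseʳ 0#)))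

    unit≉0 : ∀ i → ¬ (unit i ≈ 0#)
    unit≉0 i with i ≟ to 0#
    ... | yes _   = 1≉0
    ... | no  i≢0 = i≢0 ∘ ≡to0

    pointwise : ∀ i → unit (π ⟨$⟩ʳ i) * mass i ≈ unit i * a
    -- Scaling by `a ≉ 0` fixes the index of 0 and sends no other index to it, so the two mixed
    -- cases are impossible.
    pointwise i with i ≟ to 0# | scale a i ≟ to 0#
    ... | yes _   | yes _   = refl
    ... | yes i≡0 | no  s≢0 = contradiction
      (to-cong (trans (*-congˡ (from≈0 i≡0)) (zeroʳ a))) s≢0
    ... | no  i≢0 | yes s≡0 = contradiction (to-injective s≡0) (x*y≉0 a≉0 (i≢0 ∘ ≡to0))
    ... | no  _   | no  _   = begin
      from (to (a * from i)) * 1#  ≈⟨ *-identityʳ _ ⟩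
      from (to (a * from i))       ≈⟨ strictlyInverseʳ _ ⟩
      a * from i                   ≈⟨ *-comm a _ ⟩
      from i * a                   ∎

  1^n≈1 : ∀ n → 1# ^ n ≈ 1#
  1^n≈1 ℕ.zero    = refl
  1^n≈1 (ℕ.suc n) = trans (*-identityˡ _) (1^n≈1 n)

  -- Fermat at -1: in even cardinality, -1 = (-1)^N = 1.
  even⇒1+1≈0 : ∀ n → N ≡ 2 ℕ.* n → 1# + 1# ≈ 0#
  even⇒1+1≈0 n N≡2n = begin
    1# + 1#                   ≈⟨ +-congˡ (1^n≈1 n) ⟨
    1# + 1# ^ n               ≈⟨ +-congˡ (^-congˡ n [-1]²≈1) ⟨
    1# + ((- 1#) ^ 2) ^ n       ≈⟨ +-congˡ (^-assocʳ (- 1#) 2 n) ⟩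
    1# + (- 1#) ^ (2 ℕ.* n)     ≡⟨ ≡.cong (λ m → 1# + (- 1#) ^ m) N≡2n ⟨
    1# + (- 1#) ^ N             ≈⟨ +-congˡ (fermat (- 1#)) ⟩
    1# + - 1#                 ≈⟨ -‿inverseʳ 1# ⟩
    0#                        ∎
    where
    [-1]²≈1 : (- 1#) ^ 2 ≈ 1#
    [-1]²≈1 = begin
      - 1# * (- 1# * 1#)  ≈⟨ *-congˡ (*-identityʳ _) ⟩
      - 1# * - 1#         ≈⟨ -1*x≈-x (- 1#) ⟩
      - - 1#              ≈⟨ -‿involutive 1# ⟩
      1#                  ∎

  -- By Fermat, raising to half the cardinality produces an explicit square root.
  even⇒square : ∀ n → N ≡ 2 ℕ.* n → ∀ v → (v ^ n) ^ 2 ≈ v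
  even⇒square n N≡2n v = begin
    (v ^ n) ^ 2    ≈⟨ ^-assocʳ v n 2 ⟩
    v ^ (n ℕ.* 2)  ≡⟨ ≡.cong (v ^_) (≡.trans N≡2n (ℕ.*-comm 2 n)) ⟨
    v ^ N          ≈⟨ fermat v ⟩
    v              ∎

-- The quadratic extension of 𝔽_q for q ≥ 2: conjugation, trace and norm.

module QuadraticExtension (F : HeytingField c ℓ₁ ℓ₂) (k : ℕ)
  (card : FieldPolynomials.HasCardinality F ((2 ℕ.^ ℕ.suc k) ℕ.^ 2)) where

  open FieldPolynomials F
  open PolynomialEvaluation F
  open FiniteField F card
  open CommutativeRing commutativeRing hiding (Carrier; _≈_; _+_; _*_; 0#; 1#; zero)
  open SetoidReasoning setoid
  open SemiringExp semiring using (^-congˡ; ^-assocʳ)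
  open CommutativeSemiringExp commutativeSemiring using (^-distrib-*)

  q half : ℕ
  q    = 2 ℕ.^ ℕ.suc k
  half = 2 ℕ.^ k ℕ.* q

  q²≡2*half : q ℕ.^ 2 ≡ 2 ℕ.* half
  q²≡2*half = ≡.trans (≡.cong (q ℕ.*_) (ℕ.*-identityʳ q)) (ℕ.*-assoc 2 (2 ℕ.^ k) q)

  1+1≈0 : 1# + 1# ≈ 0#
  1+1≈0 = even⇒1+1≈0 half q²≡2*half

  2≤q : 2 ℕ.≤ q
  2≤q = ℕ.*-monoʳ-≤ 2 (ℕ.m^n>0 2 k)

  q<q² : q ℕ.< q ℕ.^ 2
  q<q² = ≡.subst (ℕ._< q ℕ.^ 2) (ℕ.^-identityʳ q) (ℕ.^-monoʳ-< q 2≤q (ℕ.n<1+n 1))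

  ^q-involutive : ∀ x → (x ^ q) ^ q ≈ x
  ^q-involutive x = begin
    (x ^ q) ^ q    ≈⟨ ^-assocʳ x q q ⟩
    x ^ (q ℕ.* q)  ≡⟨ ≡.cong (λ n → x ^ (q ℕ.* n)) (ℕ.*-identityʳ q) ⟨
    x ^ (q ℕ.^ 2)  ≈⟨ fermat x ⟩
    x              ∎

  ^q-additive : Additive (_^ q)
  ^q-additive = frobenius-additive 1+1≈0 (ℕ.suc k)

  trace norm : Carrier → Carrier
  trace x = x ^ q + x
  norm  x = x ^ q * x

  -- The subfield 𝔽_q, as the fixed points of conjugation `x ^ q`.
  Fixed : Carrier → Set _
  Fixed t = t ^ q ≈ t

  trace-fixed : ∀ x → Fixed (trace x)
  trace-fixed x = begin
    (x ^ q + x) ^ q      ≈⟨ ^q-additive (x ^ q) x ⟩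
    (x ^ q) ^ q + x ^ q  ≈⟨ +-congʳ (^q-involutive x) ⟩
    x + x ^ q            ≈⟨ +-comm x _ ⟩
    x ^ q + x            ∎

  norm-fixed : ∀ x → Fixed (norm x)
  norm-fixed x = begin
    (x ^ q * x) ^ q      ≈⟨ ^-distrib-* (x ^ q) x q ⟩
    (x ^ q) ^ q * x ^ q  ≈⟨ *-congʳ (^q-involutive x) ⟩
    x * x ^ q            ≈⟨ *-comm x _ ⟩
    x ^ q * x            ∎

  +-fixed : ∀ {s t} → Fixed s → Fixed t → Fixed (s + t)
  +-fixed {s} {t} s-fixed t-fixed = trans (^q-additive s t) (+-cong s-fixed t-fixed)

  -- Conjugating `r * s ≈ 1#` shows that `r ^ q` is also an inverse of `s`, and inverses are unique.
  inverse-fixed : ∀ {s r} → r * s ≈ 1# → Fixed s → Fixed r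
  inverse-fixed {s} {r} rs≈1 s-fixed = begin
    r ^ q              ≈⟨ *-identityʳ _ ⟨
    r ^ q * 1#         ≈⟨ *-congˡ (trans (*-comm s r) rs≈1) ⟨
    r ^ q * (s * r)    ≈⟨ *-assoc _ _ _ ⟨
    r ^ q * s * r      ≈⟨ *-congʳ (*-congˡ s-fixed) ⟨
    r ^ q * s ^ q * r  ≈⟨ *-congʳ (^-distrib-* r s q) ⟨
    (r * s) ^ q * r    ≈⟨ *-congʳ (trans (^-congˡ q rs≈1) (1^n≈1 q)) ⟩
    1# * r             ≈⟨ *-identityˡ r ⟩
    r                  ∎

  trace-scale : ∀ {c} x → Fixed c → trace (x * c) ≈ trace x * c
  trace-scale {c} x c-fixed = begin
    (x * c) ^ q + x * c    ≈⟨ +-congʳ (trans (^-distrib-* x c q) (*-congˡ c-fixed)) ⟩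
    x ^ q * c + x * c      ≈⟨ distribʳ c _ _ ⟨
    (x ^ q + x) * c        ∎

  -- The trace is 𝔽_q-linear, and not identically zero because x^q - x has at
  -- most q roots.
  fixed⇒trace : ∀ t → Fixed t → ∃ λ z → trace z ≈ t
  fixed⇒trace t t-fixed = w * (s⁻¹ * t) , (begin
    trace (w * (s⁻¹ * t))  ≈⟨ trace-scale w s⁻¹t-fixed ⟩
    s * (s⁻¹ * t)          ≈⟨ *-assoc s s⁻¹ t ⟨
    s * s⁻¹ * t            ≈⟨ *-congʳ (trans (*-comm s s⁻¹) s⁻¹s≈1) ⟩
    1# * t                 ≈⟨ *-identityˡ t ⟩
    t                      ∎)
    where
    w = proj₁ (nonFixedPoint q 2≤q q<q²)
    w-moved = proj₂ (nonFixedPoint q 2≤q q<q²)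
    s = trace w

    s≉0 : ¬ (s ≈ 0#)
    -- In characteristic 2, `w ^ q + w ≈ 0#` would say that `w` is fixed.
    s≉0 = w-moved ∘ x+y≈0⇒x≈y 1+1≈0

    s⁻¹ = proj₁ (≉0⇒invertible s≉0)
    s⁻¹s≈1 = proj₂ (≉0⇒invertible s≉0)

    s⁻¹t-fixed : Fixed (s⁻¹ * t)
    s⁻¹t-fixed = trans (^-distrib-* s⁻¹ t q)
      (*-cong (inverse-fixed s⁻¹s≈1 (trace-fixed w)) t-fixed)

  -- As `(a ^ q) ^ q ≈ a`, the expression is the trace of `x * a ^ q`; so take an element of trace
  -- `t` and divide it by `a ^ q`.
  polarisation-surjective : ∀ {a t} → ¬ (a ≈ 0#) → Fixed t →
                            ∃ λ x → x ^ q * a + x * a ^ q ≈ t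
  polarisation-surjective {a} {t} a≉0 t-fixed = x , (begin
    x ^ q * a + x * a ^ q            ≈⟨ +-congʳ (*-congˡ (^q-involutive a)) ⟨
    x ^ q * (a ^ q) ^ q + x * a ^ q  ≈⟨ +-congʳ (^-distrib-* x (a ^ q) q) ⟨
    trace (x * a ^ q)                ≈⟨ +-cong (^-congˡ q xa^q≈z) xa^q≈z ⟩
    trace z                          ≈⟨ proj₂ (fixed⇒trace t t-fixed) ⟩
    t                                ∎)
    where
    z = proj₁ (fixed⇒trace t t-fixed)
    b = proj₁ (≉0⇒invertible (x^n≉0 a≉0 q))
    x = z * b

    xa^q≈z : x * a ^ q ≈ z
    xa^q≈z = begin
      z * b * a ^ q    ≈⟨ *-assoc z b _ ⟩
      z * (b * a ^ q)  ≈⟨ *-congˡ (proj₂ (≉0⇒invertible (x^n≉0 a≉0 q))) ⟩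
      z * 1#           ≈⟨ *-identityʳ z ⟩
      z                ∎

  norm-+ : ∀ x a → norm (x + a) ≈ norm x + (x ^ q * a + x * a ^ q + norm a)
  norm-+ x a = begin
    (x + a) ^ q * (x + a)      ≈⟨ *-congʳ (^q-additive x a) ⟩
    (x ^ q + a ^ q) * (x + a)  ≈⟨ S.solve 4 (λ x a u v →
      (u S.:+ v) S.:* (x S.:+ a) S.:=
      u S.:* x S.:+ (u S.:* a S.:+ x S.:* v S.:+ v S.:* a)) refl x a (x ^ q) (a ^ q) ⟩
    norm x + (x ^ q * a + x * a ^ q + norm a)  ∎

  -- Sums do the work of differences in characteristic 2.
  additive∧kernel⇒injective : ∀ {f} → Additive f → Congruent _≈_ _≈_ f →
    (∀ {v} → f v ≈ 0# → v ≈ 0#) → Injective _≈_ _≈_ f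
  additive∧kernel⇒injective {f} f-add f-cong ker {x} {y} fx≈fy =
    x+y≈0⇒x≈y 1+1≈0 (ker (begin
      f (x + y)  ≈⟨ f-add x y ⟩
      f x + f y  ≈⟨ +-congʳ fx≈fy ⟩
      f y + f y  ≈⟨ x+x≈0 1+1≈0 (f y) ⟩
      0#         ∎))

  -- The criterion for additive maps `L₀`, `L₁` and `f(x) = L₁(norm x) + L₀(x²)`.

  module _ {f L₀ L₁ : Carrier → Carrier}
    (L₀-cong : Congruent _≈_ _≈_ L₀) (L₀-additive : Additive L₀)
    (L₁-cong : Congruent _≈_ _≈_ L₁) (L₁-additive : Additive L₁)
    (f-value : ∀ x → f x ≈ L₁ (norm x) + L₀ (x ^ 2)) where

    private
      f-cong : Congruent _≈_ _≈_ f
      f-cong {x} {y} x≈y = begin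
        f x                       ≈⟨ f-value x ⟩
        L₁ (norm x) + L₀ (x ^ 2)  ≈⟨ +-cong (L₁-cong (*-cong (^-congˡ q x≈y) x≈y)) (L₀-cong (^-congˡ 2 x≈y)) ⟩
        L₁ (norm y) + L₀ (y ^ 2)  ≈⟨ f-value y ⟨
        f y                       ∎

    module _ (f-injective : Injective _≈_ _≈_ f) where

      -- Choose x with x^q a + x a^q = t + a^(q+1); then f(x + a) = f(x).
      L₀a²≈L₁t⇒a≈0 : ∀ {a t} → Fixed t → L₀ (a ^ 2) ≈ L₁ t → a ≈ 0#
      L₀a²≈L₁t⇒a≈0 {a} {t} t-fixed eq with a ≈? 0#
      ... | yes a≈0 = a≈0
      ... | no  a≉0 = +-cancelˡ x a 0# (trans (f-injective f[x+a]≈f[x]) (sym (+-identityʳ x)))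
        where
        open RingProperties ring using (+-cancelˡ)

        -- The target `t + norm a` is chosen so that `norm a` cancels the last term of `norm-+`. The
        -- norm then grows by exactly `t`, and `f` by `L₁ t + L₀ (a ^ 2)`, which is twice `L₁ t` and
        -- so vanishes.
        x = proj₁ (polarisation-surjective a≉0 (+-fixed t-fixed (norm-fixed a)))
        x-solves = proj₂ (polarisation-surjective a≉0 (+-fixed t-fixed (norm-fixed a)))

        norm[x+a] : norm (x + a) ≈ norm x + t
        norm[x+a] = begin
          norm (x + a)                               ≈⟨ norm-+ x a ⟩
          norm x + (x ^ q * a + x * a ^ q + norm a)  ≈⟨ +-congˡ (+-congʳ x-solves) ⟩
          norm x + (t + norm a + norm a)             ≈⟨ +-congˡ (x+y+y≈x 1+1≈0 t (norm a)) ⟩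
          norm x + t                                 ∎

        f[x+a]≈f[x] : f (x + a) ≈ f x
        f[x+a]≈f[x] = begin
          f (x + a)                                          ≈⟨ f-value (x + a) ⟩
          L₁ (norm (x + a)) + L₀ ((x + a) ^ 2)               ≈⟨ +-cong
            (trans (L₁-cong norm[x+a]) (L₁-additive (norm x) t))
            (trans (L₀-cong (square-additive 1+1≈0 x a)) (L₀-additive _ _)) ⟩
          L₁ (norm x) + L₁ t + (L₀ (x ^ 2) + L₀ (a ^ 2))     ≈⟨ +-congˡ (+-congˡ eq) ⟩
          L₁ (norm x) + L₁ t + (L₀ (x ^ 2) + L₁ t)           ≈⟨ S.solve 3 (λ u v w →
            u S.:+ v S.:+ (w S.:+ v) S.:= u S.:+ w S.:+ v S.:+ v)
            refl (L₁ (norm x)) (L₁ t) (L₀ (x ^ 2)) ⟩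
          L₁ (norm x) + L₀ (x ^ 2) + L₁ t + L₁ t             ≈⟨ x+y+y≈x 1+1≈0 _ _ ⟩
          L₁ (norm x) + L₀ (x ^ 2)                           ≈⟨ f-value x ⟨
          f x                                                ∎

      -- Every `v` is a square, so the restriction to arguments `a ^ 2` can be lifted.
      L₀v≈L₁t⇒v≈0 : ∀ {v t} → Fixed t → L₀ v ≈ L₁ t → v ≈ 0#
      L₀v≈L₁t⇒v≈0 {v} {t} t-fixed eq = begin
        v                ≈⟨ even⇒square half q²≡2*half v ⟨
        (v ^ half) ^ 2   ≈⟨ ^-congˡ 2 (L₀a²≈L₁t⇒a≈0 t-fixed
                              (trans (L₀-cong (even⇒square half q²≡2*half v)) eq)) ⟩
        0# ^ 2           ≈⟨ zeroˡ _ ⟩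
        0#               ∎

      -- The case `t = 0`, since `L₁` sends 0 to 0.
      injective⇒kernel : ∀ {v} → L₀ v ≈ 0# → v ≈ 0#
      injective⇒kernel L₀v≈0 = L₀v≈L₁t⇒v≈0 (additive⇒0 (^-congˡ q) ^q-additive)
        (trans L₀v≈0 (sym (additive⇒0 L₁-cong L₁-additive)))

      -- A trivial kernel makes `L₀` onto, so `L₁ (trace v)` equals some `L₀ u`. Traces lie in 𝔽_q,
      -- which forces `u ≈ 0#`.
      injective⇒L₁∘trace : ∀ v → L₁ (trace v) ≈ 0#
      injective⇒L₁∘trace v = begin
        L₁ (trace v)  ≈⟨ L₀u≈ ⟨
        L₀ u          ≈⟨ L₀-cong (L₀v≈L₁t⇒v≈0 (trace-fixed v) L₀u≈) ⟩
        L₀ 0#         ≈⟨ additive⇒0 L₀-cong L₀-additive ⟩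
        0#            ∎
        where
        L₀-bijective = injective⇒bijective L₀-cong
          (additive∧kernel⇒injective L₀-additive L₀-cong injective⇒kernel)
        u = proj₁ (proj₂ L₀-bijective (L₁ (trace v)))

        L₀u≈ : L₀ u ≈ L₁ (trace v)
        L₀u≈ = proj₂ (proj₂ L₀-bijective (L₁ (trace v))) refl

    module _ (L₁∘trace : ∀ v → L₁ (trace v) ≈ 0#) (kernel : ∀ {v} → L₀ v ≈ 0# → v ≈ 0#) where

      -- Norms lie in 𝔽_q, hence are traces, and `L₁` vanishes on traces.
      f≈L₀∘square : ∀ x → f x ≈ L₀ (x ^ 2)
      f≈L₀∘square x = begin
        f x                       ≈⟨ f-value x ⟩
        L₁ (norm x) + L₀ (x ^ 2)  ≈⟨ +-congʳ (L₁-cong (proj₂ (fixed⇒trace _ (norm-fixed x)))) ⟨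
        L₁ (trace _) + L₀ (x ^ 2) ≈⟨ +-congʳ (L₁∘trace _) ⟩
        0# + L₀ (x ^ 2)           ≈⟨ +-identityˡ _ ⟩
        L₀ (x ^ 2)                ∎

      square-kernel : ∀ {x} → x ^ 2 ≈ 0# → x ≈ 0#
      square-kernel {x} x²≈0 with x ≈? 0#
      ... | yes x≈0 = x≈0
      ... | no  x≉0 = contradiction x²≈0 (x^n≉0 x≉0 2)

      -- `f` is squaring followed by `L₀`, both additive with trivial kernel; finiteness then gives
      -- surjectivity.
      kernel⇒bijective : Bijective _≈_ _≈_ f
      kernel⇒bijective = injective⇒bijective f-cong λ {x} {y} fx≈fy →
        additive∧kernel⇒injective (square-additive 1+1≈0) (^-congˡ 2) square-kernel
          (additive∧kernel⇒injective L₀-additive L₀-cong kernel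
            (trans (sym (f≈L₀∘square x)) (trans fx≈fy (f≈L₀∘square y))))

-- Disposes of `q = 2 ^ 0`, where the field would have a single element.
¬HasCardinality1 : (F : HeytingField c ℓ₁ ℓ₂) → ¬ FieldPolynomials.HasCardinality F 1
¬HasCardinality1 F card = 1≉0 (to-injective (Fin1-unique _ _))
  where
  open FiniteField F card

  Fin1-unique : (i j : Fin 1) → i ≡ j
  Fin1-unique zero zero = ≡.refl

theorem6 : {c ℓ₁ ℓ₂ : Level} (F : HeytingField c ℓ₁ ℓ₂) →
    let open FieldPolynomials F in
    (q : ℕ) → ∃ (λ k → q ≡ 2 ℕ.^ k) → HasCardinality (q ℕ.^ 2) →
    {m n : ℕ} (a : Vector Carrier m) (b : Vector Carrier n) →
    let L₀ = twoLinear a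
        L₁ = twoLinear b
    in
    IsPermutationPolynomial ((L₁ ∘ₚ (X^ (q ℕ.+ 1))) +ₚ (L₀ ∘ₚ (X^ 2)))
      ⇔ ((∀ v → ⟦ L₁ ⟧ (v ^ q + v) ≈ 0#) × (Ker L₀ ≐ (λ v → v ≈ 0#)))
theorem6 F _ (ℕ.zero  , ≡.refl) card a b = contradiction card (¬HasCardinality1 F)
theorem6 F q (ℕ.suc k , ≡.refl) card a b = mk⇔
  (λ (f-injective , _) →
    injective⇒L₁∘trace L₀-cong L₀-additive L₁-cong L₁-additive f-value f-injective ,
    injective⇒kernel L₀-cong L₀-additive L₁-cong L₁-additive f-value f-injective ,
    -- The kernel condition is an equality of predicates; this is the inclusion of 0 in the kernel.
    λ v≈0 → trans (L₀-cong v≈0) (additive⇒0 L₀-cong L₀-additive))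
  (λ (L₁∘trace , kernel , _) →
    kernel⇒bijective L₀-cong L₀-additive L₁-cong L₁-additive f-value L₁∘trace kernel)
  where
  open FieldPolynomials F
  open PolynomialEvaluation F
  open QuadraticExtension F k card hiding (q)
  open CommutativeRing commutativeRing using (setoid; refl; trans; +-cong; *-congˡ; *-identityʳ; semiring)
  open SemiringExp semiring using (^-homo-*)
  open SetoidReasoning setoid

  L₀ L₁ : Poly
  L₀ = twoLinear a
  L₁ = twoLinear b

  L₀-cong = ⟦⟧-cong L₀
  L₁-cong = ⟦⟧-cong L₁
  L₀-additive = twoLinear-additive 1+1≈0 a
  L₁-additive = twoLinear-additive 1+1≈0 b

  -- Passes from formal polynomials to maps; `x ^ (q + 1)` becomes `x ^ q * x`, the norm.
  f-value : ∀ x → ⟦ (L₁ ∘ₚ (X^ (q ℕ.+ 1))) +ₚ (L₀ ∘ₚ (X^ 2)) ⟧ x ≈ ⟦ L₁ ⟧ (norm x) + ⟦ L₀ ⟧ (x ^ 2)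
  f-value x = begin
    ⟦ (L₁ ∘ₚ (X^ (q ℕ.+ 1))) +ₚ (L₀ ∘ₚ (X^ 2)) ⟧ x     ≈⟨ ⟦+ₚ⟧ (L₁ ∘ₚ (X^ (q ℕ.+ 1))) _ x ⟩
    ⟦ L₁ ∘ₚ (X^ (q ℕ.+ 1)) ⟧ x + ⟦ L₀ ∘ₚ (X^ 2) ⟧ x    ≈⟨ +-cong
      (trans (⟦∘ₚ⟧ L₁ _ x) (L₁-cong (⟦X^⟧ (q ℕ.+ 1) x)))
      (trans (⟦∘ₚ⟧ L₀ _ x) (L₀-cong (⟦X^⟧ 2 x))) ⟩
    ⟦ L₁ ⟧ (x ^ (q ℕ.+ 1)) + ⟦ L₀ ⟧ (x ^ 2)            ≈⟨ +-cong
      (L₁-cong (trans (^-homo-* x q 1) (*-congˡ (*-identityʳ x)))) refl ⟩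
    ⟦ L₁ ⟧ (norm x) + ⟦ L₀ ⟧ (x ^ 2)                   ∎
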